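{- Let $G=\langle V,E\rangle$ be an undirected graph of order $n$ and let $G'=\langle V',E',S,D,L\rangle$ be the labeled multistage graph constructed from $G$. Then $G$ is a Hamilton graph if and only if $G'$ has a simple path from $S$ to $D$.
   Context: A labeled multistage graph $\langle V,E,S,D,L\rangle$ is a finite directed graph such that: (1) $V=V_0\cup V_1\cup\dots\cup V_L$ with $V_i\cap V_j=\emptyset$ for $i\neq j$; a vertex $u \in V_i$ is said to be of stage $i$; (2) $E$ is a set of directed edges, each written as a triple $\langle u,v,l\rangle$ (an edge of stage $l$), where $1\le l\le L$, $u\in V_{l-1}$, $v\in V_l$; (3) $V_0=\{S\}$ and $V_L=\{D\}$; (4) each $v\in V\setminus\{S\}$ is labeled with a subset $E(v)\subseteq E$. A simple path in a labeled multistage graph is a path $S-u_1-\dots-u_l-\dots-u_L$ with $u_L=D$ such that for every $l\in\{1,\dots,L\}$ all edges of the initial segment $S-u_1-\dots-u_l$ are contained in $E(u_l)$. An undirected graph is a Hamilton graph if it has a Hamilton circuit, i.e. a circuit visiting each vertex exactly once. Construction of $G'$ from $G=\langle V,E\rangle$ of order $n$: (1) $L=n$. (2) Select a vertex $v\in V$; put vertices $(v,0)$ and $(v,n)$ in $V'$; let $S=(v,0)$, $D=(v,n)$. (3) For all $u\in V\setminus\{v\}$, put in $V'$ the vertices $(u,1)$ of stage $1$, $(u,2)$ of stage $2$, ..., $(u,L-1)$ of stage $L-1$. (4) For all $(a,b)\in E$ with $a\neq v$, $b\neq v$, put in $E'$ the edges $\langle(a,1),(b,2),2\rangle,\dots,\langle(a,L-2),(b,L-1),L-1\rangle$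 and $\langle(b,1),(a,2),2\rangle,\dots,\langle(b,L-2),(a,L-1),L-1\rangle$; for all $(v,b)\in E$, put in $E'$ the edge from $(v,0)$ to $(b,1)$ (stage $1$) and the edge from $(b,L-1)$ to $(v,n)$ (stage $L$). (5) $E(u,l)=E'\setminus\{e\in E'\mid e \text{ is incident with } (u,1),\dots,\text{ or } (u,l-1)\}$ for $1\le l\le L-1$. (6) $E(D)=E(v,n)=E'$. -}

module Defs where

open import Data.Empty using (⊥-elim)
import Data.Empty.Irrelevant as Irr
open import Data.Fin.Base using (Fin; zero; suc; toℕ; fromℕ; fromℕ<; inject₁)
open import Data.Fin.Properties using (_≟_; toℕ<n; toℕ-fromℕ<)
open import Data.List.Base using (List; _∷_; allFin; cartesianProductWith)
open import Data.List.Membership.Propositional using () renaming (_∈_ to _∈ₗ_)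
open import Data.List.Membership.Propositional.Properties
  using (∈-allFin; ∈-cartesianProductWith⁺)
open import Data.List.Relation.Unary.Any using (here; there)
open import Data.Nat.Base using (ℕ; suc; _∸_; _≤_; _<_; z≤n; s≤s)
open import Data.Nat.Properties
  using (≤-refl; ≤-trans; <⇒≤; <-trans; <-irrefl; _≤?_; _<?_; n≮0)
open import Data.Product using (∃; ∃-syntax; ∃!; _×_; _,_)
open import Data.Sum.Base using (_⊎_)
open import Function.Bundles using (_⇔_; mk⇔; Equivalence)
open import Level using (0ℓ)
open import Relation.Binary.Core using (Rel)
open import Relation.Binary.Definitions using (Symmetric; Irreflexive)
open import Relation.Binary.PropositionalEquality
  using (_≡_; _≢_; refl; sym; trans; subst)
open import Relation.Nullary.Decidable using (yes; no; recompute)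
open import Relation.Nullary.Negation using (¬_)
open import Relation.Unary using (Pred; _∈_; _⊆_)

record Graph (n : ℕ) : Set₁ where
  field
    Adj    : Rel (Fin n) 0ℓ
    symm   : Symmetric Adj
    irrefl : Irreflexive _≡_ Adj

-- A circuit is a closed walk; on three or more vertices, one that visits every
-- vertex exactly once has pairwise distinct edges.  On two adjacent vertices a, b
-- the circuit a - b - a is admitted.
record Circuit {n : ℕ} (G : Graph n) (k : ℕ) : Set where
  open Graph G
  field
    vertex   : Fin (suc k) → Fin n
    adjacent : ∀ (i : Fin k) → Adj (vertex (inject₁ i)) (vertex (suc i))
    closed   : vertex (fromℕ k) ≡ vertex zero

-- The final occurrence of the base point of the circuit is not counted.
VisitsEachOnce : ∀ {n k} {G : Graph n} → Circuit G k → Set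
VisitsEachOnce {n} {k} c =
  ∀ (x : Fin n) → ∃! _≡_ λ (i : Fin k) → Circuit.vertex c (inject₁ i) ≡ x

IsHamilton : ∀ {n} → Graph n → Set
IsHamilton G = ∃[ k ] ∃ λ (c : Circuit G k) → VisitsEachOnce c

record LabeledMultistageGraph : Set₁ where
  field
    V          : Set
    finite     : ∃ λ (xs : List V) → ∀ x → x ∈ₗ xs
    L          : ℕ
    -- Vᵢ is the fibre of stage over i, so that V₀, …, V_L partition V.
    stage      : V → ℕ
    stage≤L    : ∀ x → stage x ≤ L
    E          : Pred (V × V × ℕ) 0ℓ
    edge-stage : ∀ {x y l} → (x , y , l) ∈ E →
                 1 ≤ l × l ≤ L × stage x ≡ l ∸ 1 × stage y ≡ l
    S D        : V
    V₀≡｛S｝    : ∀ x → stage x ≡ 0 ⇔ x ≡ S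
    V_L≡｛D｝   : ∀ x → stage x ≡ L ⇔ x ≡ D
    label      : ∀ x → .(x ≢ S) → Pred (V × V × ℕ) 0ℓ
    label⊆E    : ∀ x .(x≢S : x ≢ S) → label x x≢S ⊆ E

  target≢S : ∀ {x y l} → (x , y , l) ∈ E → y ≢ S
  target≢S {y = y} e y≡S with edge-stage e
  ... | 1≤l , _ , _ , st =
    n≮0 (subst (1 ≤_) (trans (sym st) (Equivalence.from (V₀≡｛S｝ y) y≡S)) 1≤l)

record SimplePath (M : LabeledMultistageGraph) : Set where
  open LabeledMultistageGraph M
  field
    vertex : Fin (suc L) → V
    start  : vertex zero ≡ S
    end    : vertex (fromℕ L) ≡ D

  -- For i : Fin L this is the edge of stage i + 1.
  edge : Fin L → V × V × ℕ
  edge i = vertex (inject₁ i) , vertex (suc i) , suc (toℕ i)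

  field
    edge∈E : ∀ i → edge i ∈ E
    simple : ∀ (l i : Fin L) → toℕ i ≤ toℕ l →
             edge i ∈ label (vertex (suc l)) (target≢S (edge∈E l))

module Construction {n : ℕ} (G : Graph n) (v : Fin n) where
  open Graph G

  -- source, inner u l and sink are (v , 0), (u , l) and (v , n).
  data Vertex : Set where
    source : Vertex
    inner  : (u : Fin n) .(u≢v : u ≢ v) (l : ℕ) .(1≤l : 1 ≤ l) .(l<n : l < n) → Vertex
    sink   : Vertex

  stage : Vertex → ℕ
  stage source            = 0
  stage (inner _ _ l _ _) = l
  stage sink              = n

  Edge : Set
  Edge = Vertex × Vertex × ℕ

  -- Adj is symmetric, so middle yields both orientations of each edge of G.
  data E′ : Pred Edge 0ℓ where
    first  : ∀ {b} .{b≢v : b ≢ v} .{1≤1 : 1 ≤ 1} .{1<n : 1 < n} → Adj v b →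
             E′ (source , inner b b≢v 1 1≤1 1<n , 1)
    middle : ∀ {a b l} .{a≢v : a ≢ v} .{b≢v : b ≢ v}
             .{1≤l : 1 ≤ l} .{l<n : l < n} .{1≤1+l : 1 ≤ suc l} .{1+l<n : suc l < n} →
             Adj a b →
             E′ (inner a a≢v l 1≤l l<n , inner b b≢v (suc l) 1≤1+l 1+l<n , suc l)
    last   : ∀ {b} .{b≢v : b ≢ v} .{1≤n-1 : 1 ≤ n ∸ 1} .{n-1<n : n ∸ 1 < n} → Adj v b →
             E′ (inner b b≢v (n ∸ 1) 1≤n-1 n-1<n , sink , n)

  Incident : Edge → Vertex → Set
  Incident (x , y , _) z = z ≡ x ⊎ z ≡ y

  label : ∀ x → .(x ≢ source) → Pred Edge 0ℓ
  label source              s≢s _ = Irr.⊥-elim (s≢s refl)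
  label (inner u u≢v l _ l<n) _ e =
    e ∈ E′ ×
    (∀ m (1≤m : 1 ≤ m) (m<l : m < l) →
       ¬ Incident e (inner u u≢v m 1≤m (<-trans m<l l<n)))
  label sink                  _ e = e ∈ E′

  private
    1≤n : 1 ≤ n
    1≤n = ≤-trans (s≤s z≤n) (toℕ<n v)

    fromPair : Fin n → Fin n → Vertex
    fromPair u l with u ≟ v | 1 ≤? toℕ l
    ... | no u≢v | yes 1≤l = inner u u≢v (toℕ l) 1≤l (toℕ<n l)
    ... | _      | _       = source

    inner-cong : ∀ {u l m} .(u≢v : u ≢ v) → l ≡ m →
                 .(1≤l : 1 ≤ l) .(l<n : l < n) .(1≤m : 1 ≤ m) .(m<n : m < n) →
                 inner u u≢v l 1≤l l<n ≡ inner u u≢v m 1≤m m<n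
    inner-cong _ refl _ _ _ _ = refl

    fromPair-inner : ∀ u .(u≢v : u ≢ v) l .(1≤l : 1 ≤ l) (l<n : l < n) →
                     inner u u≢v l 1≤l l<n ≡ fromPair u (fromℕ< l<n)
    fromPair-inner u u≢v l 1≤l l<n with u ≟ v | 1 ≤? toℕ (fromℕ< l<n)
    ... | yes u≡v | _      = Irr.⊥-elim (u≢v u≡v)
    ... | no _    | yes 1≤ = inner-cong u≢v (sym (toℕ-fromℕ< l<n)) 1≤l l<n 1≤ (toℕ<n _)
    ... | no _    | no 1≰  =
      Irr.⊥-elim (1≰ (subst (1 ≤_) (sym (toℕ-fromℕ< l<n)) 1≤l))

    finite : ∃ λ (xs : List Vertex) → ∀ x → x ∈ₗ xs
    finite = source ∷ sink ∷ cartesianProductWith fromPair (allFin n) (allFin n) , complete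
      where
      complete : ∀ x → x ∈ₗ _
      complete source = here refl
      complete sink   = there (here refl)
      complete (inner u u≢v l 1≤l l<n) = there (there
        (subst (_∈ₗ _) (sym (fromPair-inner u u≢v l 1≤l l<n′))
          (∈-cartesianProductWith⁺ fromPair (∈-allFin u) (∈-allFin (fromℕ< l<n′)))))
        where
        l<n′ : l < n
        l<n′ = recompute (l <? n) l<n

    stage≤n : ∀ x → stage x ≤ n
    stage≤n source              = z≤n
    stage≤n (inner _ _ l _ l<n) = <⇒≤ (recompute (l <? n) l<n)
    stage≤n sink                = ≤-refl

    edge-stage : ∀ {x y l} → E′ (x , y , l) →
                 1 ≤ l × l ≤ n × stage x ≡ l ∸ 1 × stage y ≡ l
    edge-stage (first _)                        = ≤-refl , 1≤n , refl , refl
    edge-stage (middle {l = l} {1+l<n = 1+l<n} _) =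
      s≤s z≤n , <⇒≤ (recompute (suc l <? n) 1+l<n) , refl , refl
    edge-stage (last _)                         = 1≤n , ≤-refl , refl , refl

    stage-0 : ∀ x → stage x ≡ 0 ⇔ x ≡ source
    stage-0 x = mk⇔ (to x) λ { refl → refl }
      where
      to : ∀ x → stage x ≡ 0 → x ≡ source
      to source                refl = refl
      to (inner _ _ _ 1≤l _)   refl = Irr.⊥-elim (n≮0 1≤l)
      to sink                  eq   = ⊥-elim (n≮0 (subst (1 ≤_) eq 1≤n))

    stage-n : ∀ x → stage x ≡ n ⇔ x ≡ sink
    stage-n x = mk⇔ (to x) λ { refl → refl }
      where
      to : ∀ x → stage x ≡ n → x ≡ sink
      to source                eq = ⊥-elim (n≮0 (subst (1 ≤_) (sym eq) 1≤n))
      to (inner _ _ _ _ l<n)   eq = Irr.⊥-elim (<-irrefl eq l<n)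
      to sink                  _  = refl

    label⊆E′ : ∀ x .(x≢s : x ≢ source) → label x x≢s ⊆ E′
    label⊆E′ source              s≢s _       = Irr.⊥-elim (s≢s refl)
    label⊆E′ (inner _ _ _ _ _)   _ (e∈E′ , _) = e∈E′
    label⊆E′ sink                _ e∈E′      = e∈E′

  G′ : LabeledMultistageGraph
  G′ = record
    { V          = Vertex
    ; finite     = finite
    ; L          = n
    ; stage      = stage
    ; stage≤L    = stage≤n
    ; E          = E′
    ; edge-stage = edge-stage
    ; S          = source
    ; D          = sink
    ; V₀≡｛S｝    = stage-0
    ; V_L≡｛D｝   = stage-n
    ; label      = label
    ; label⊆E    = label⊆E′
    }

open Construction public using (G′)

-- A Hamilton circuit through v becomes a simple path by reading its i-th vertex u,
-- counted from v, as (u , i).  Conversely, a path in G′ meets each stage once, and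
-- projects to a closed walk of length n based at v.  If that walk met u ≠ v at stages
-- i < j, then the edge of the path leaving (u , i) would have to lie in E(u , j),
-- which excludes it.  So the walk does not repeat a vertex before it closes, and
-- having length n it visits every vertex.
module Submission where

open import Defs
open import Data.Nat.Base using (ℕ)
open import Data.Fin.Base using (Fin)
open import Function.Bundles using (_⇔_)

import Data.Empty.Irrelevant as Irr
open import Data.Fin.Base using (zero; suc; toℕ; fromℕ; inject₁; punchOut)
open import Data.Fin.Properties
  using (_≟_; any?; nonZeroIndex; injective⇒≤; punchOut-injective; toℕ-injective;
         toℕ-fromℕ; toℕ-fromℕ<; toℕ-inject₁; toℕ<n)
open import Data.Nat.Base
  using (zero; suc; _+_; _*_; _∸_; _≤_; _<_; z<s; s≤s⁻¹; NonZero)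
open import Data.Nat.DivMod
  using (_/_; _%_; _mod_; m≡m%n+[m/n]*n; m<n⇒m%n≡m; m%n<n; n%n≡0; [m+n]%n≡m%n;
         [m+kn]%n≡m%n; %-distribˡ-+)
open import Data.Nat.Properties
  using (_<?_; ≤-refl; ≤-antisym; ≤-trans; <-irrefl; <⇒≤; ≮⇒≥; <⇒≱; <-cmp; <-trans;
         +-assoc; +-comm; m+[n∸m]≡n)
open import Data.Product using (∃; _,_; proj₁; proj₂)
open import Data.Sum.Base using (inj₁; inj₂)
open import Function.Base using (_∘_)
open import Function.Bundles using (mk⇔)
open import Function.Definitions using (Injective)
open import Relation.Binary.Definitions using (tri<; tri≈; tri>)
open import Relation.Binary.PropositionalEquality
  using (_≡_; _≢_; refl; sym; trans; cong; subst; subst₂; module ≡-Reasoning)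
open import Relation.Nullary.Decidable using (yes; no)
open import Relation.Nullary.Negation using (contradiction)
open import Relation.Unary using (_∈_)

-- Injections of a finite set into itself.

injective⇒hits : ∀ {n} {f : Fin n → Fin n} → Injective _≡_ _≡_ f →
                 ∀ x → ∃ λ i → f i ≡ x
injective⇒hits {suc n} {f} inj x with any? (λ i → f i ≟ x)
... | yes hit  = hit
-- A missed `x` could be punched out of the codomain, leaving an injection into a set with one
-- element fewer.
... | no  miss =
  contradiction (injective⇒≤ {f = avoid} (inj ∘ punchOut-injective (x≢f _) (x≢f _)))
                (<-irrefl refl)
  where
  x≢f : ∀ i → x ≢ f i
  x≢f i x≡fi = miss (i , sym x≡fi)

  avoid : Fin (suc n) → Fin n
  avoid i = punchOut (x≢f i)

-- Residues modulo `n`, for rotating a circuit.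

module _ (n : ℕ) .{{_ : NonZero n}} where
  open ≡-Reasoning

  -- Adding `n ∸ i` completes the shift by `i` to a full turn, which vanishes modulo `n`.
  %-cancelʳ-+ : ∀ {i a b} → i ≤ n → a < n → b < n → (a + i) % n ≡ (b + i) % n → a ≡ b
  %-cancelʳ-+ {i} {a} {b} i≤n a<n b<n eq = begin
    a                                      ≡⟨ shift a<n ⟨
    ((a + i) % n + (n ∸ i) % n) % n        ≡⟨ cong (λ r → (r + (n ∸ i) % n) % n) eq ⟩
    ((b + i) % n + (n ∸ i) % n) % n        ≡⟨ shift b<n ⟩
    b                                      ∎
    where
    shift : ∀ {c} → c < n → ((c + i) % n + (n ∸ i) % n) % n ≡ c
    shift {c} c<n = begin
      ((c + i) % n + (n ∸ i) % n) % n  ≡⟨ %-distribˡ-+ (c + i) (n ∸ i) n ⟨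
      (c + i + (n ∸ i)) % n            ≡⟨ cong (_% n) (+-assoc c i (n ∸ i)) ⟩
      (c + (i + (n ∸ i))) % n          ≡⟨ cong (λ k → (c + k) % n) (m+[n∸m]≡n i≤n) ⟩
      (c + n) % n                      ≡⟨ [m+n]%n≡m%n c n ⟩
      c % n                            ≡⟨ m<n⇒m%n≡m c<n ⟩
      c                                ∎

  suc-% : ∀ m → suc m % n ≡ suc (m % n) % n
  suc-% m = begin
    suc m % n                        ≡⟨ cong (λ k → suc k % n) (m≡m%n+[m/n]*n m n) ⟩
    (suc (m % n) + m / n * n) % n    ≡⟨ [m+kn]%n≡m%n (suc (m % n)) (m / n) n ⟩
    suc (m % n) % n                  ∎

  toℕ-mod : ∀ m → toℕ (m mod n) ≡ m % n
  toℕ-mod m = toℕ-fromℕ< (m%n<n m n)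

  mod-cong : ∀ {a b} → a % n ≡ b % n → a mod n ≡ b mod n
  mod-cong {a} {b} eq = toℕ-injective (trans (toℕ-mod a) (trans eq (sym (toℕ-mod b))))

-- Hamilton circuits started at a prescribed vertex.

module _ {n : ℕ} (G : Graph n) where
  open Graph G

  -- Positions are natural numbers so that they can be matched directly with the stages of `G′`;
  -- values of `at` beyond `n` are arbitrary.
  record HamiltonTour (v : Fin n) : Set where
    field
      at        : ℕ → Fin n
      at-0      : at 0 ≡ v
      at-n      : at n ≡ v
      adjacent  : ∀ {i} → i < n → Adj (at i) (at (suc i))
      injective : ∀ {i j} → i < n → j < n → at i ≡ at j → i ≡ j

  -- Taking positions to vertices and vertices to their unique positions gives injections both ways.
  VisitsEachOnce⇒length≡n : ∀ {k} {c : Circuit G k} → VisitsEachOnce c → k ≡ n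
  VisitsEachOnce⇒length≡n {k} {c} once =
    ≤-antisym (injective⇒≤ vertex-injective) (injective⇒≤ position-injective)
    where
    open Circuit c

    vertex-injective : Injective _≡_ _≡_ (vertex ∘ inject₁)
    vertex-injective {i} {j} eq with once (vertex (inject₁ j))
    ... | _ , _ , unique = trans (sym (unique eq)) (unique refl)

    position-injective : Injective _≡_ _≡_ (proj₁ ∘ once)
    position-injective {x} {y} eq =
      trans (sym (proj₁ (proj₂ (once x))))
            (trans (cong (vertex ∘ inject₁) eq) (proj₁ (proj₂ (once y))))

  -- Reading positions modulo `k` allows the circuit to be started at any of its vertices.
  Circuit-cyclic : ∀ {k} .{{_ : NonZero k}} (c : Circuit G k) m →
                   Adj (Circuit.vertex c (inject₁ (m mod k)))
                       (Circuit.vertex c (inject₁ (suc m mod k)))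
  Circuit-cyclic {k} c m = subst (Adj _) (sym next) (adjacent (m mod k))
    where
    open Circuit c
    open ≡-Reasoning

    next : vertex (inject₁ (suc m mod k)) ≡ vertex (suc (m mod k))
    next with suc (m % k) <? k
    ... | yes m%k+1<k = cong vertex (toℕ-injective (begin
      toℕ (inject₁ (suc m mod k))  ≡⟨ toℕ-inject₁ (suc m mod k) ⟩
      toℕ (suc m mod k)            ≡⟨ toℕ-mod k (suc m) ⟩
      suc m % k                    ≡⟨ suc-% k m ⟩
      suc (m % k) % k              ≡⟨ m<n⇒m%n≡m m%k+1<k ⟩
      suc (m % k)                  ≡⟨ cong suc (toℕ-mod k m) ⟨
      suc (toℕ (m mod k))          ∎))
    -- The walk stands at the last counted position: its successor wraps to 0, and `closed`
    -- identifies the two ends.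
    ... | no  m%k+1≮k = begin
      vertex (inject₁ (suc m mod k))  ≡⟨ cong vertex (toℕ-injective wraps) ⟩
      vertex zero                     ≡⟨ closed ⟨
      vertex (fromℕ k)                ≡⟨ cong vertex (toℕ-injective final) ⟩
      vertex (suc (m mod k))          ∎
      where
      m%k+1≡k : suc (m % k) ≡ k
      m%k+1≡k = ≤-antisym (m%n<n m k) (≮⇒≥ m%k+1≮k)

      wraps : toℕ (inject₁ (suc m mod k)) ≡ 0
      wraps = begin
        toℕ (inject₁ (suc m mod k))  ≡⟨ toℕ-inject₁ (suc m mod k) ⟩
        toℕ (suc m mod k)            ≡⟨ toℕ-mod k (suc m) ⟩
        suc m % k                    ≡⟨ suc-% k m ⟩
        suc (m % k) % k              ≡⟨ cong (_% k) m%k+1≡k ⟩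
        k % k                        ≡⟨ n%n≡0 k ⟩
        0                            ∎

      final : toℕ (fromℕ k) ≡ suc (toℕ (m mod k))
      final = begin
        toℕ (fromℕ k)        ≡⟨ toℕ-fromℕ k ⟩
        k                    ≡⟨ m%k+1≡k ⟨
        suc (m % k)          ≡⟨ cong suc (toℕ-mod k m) ⟨
        suc (toℕ (m mod k))  ∎

  IsHamilton⇒HamiltonTour : IsHamilton G → ∀ v → HamiltonTour v
  IsHamilton⇒HamiltonTour (k , c , once) v with VisitsEachOnce⇒length≡n {c = c} once
  ... | refl = record
    { at        = at
    ; at-0      = trans (cong (vertex ∘ inject₁) base-mod) (proj₁ (proj₂ (once v)))
    ; at-n      = trans (cong (vertex ∘ inject₁) (trans n+base-mod base-mod))
                        (proj₁ (proj₂ (once v)))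
    ; adjacent  = λ {i} _ → Circuit-cyclic c (i + toℕ base)
    ; injective = at-injective
    }
    where
    open Circuit c
    instance
      n≢0 : NonZero n
      n≢0 = nonZeroIndex v

    base : Fin n
    base = proj₁ (once v)

    at : ℕ → Fin n
    -- Rotation by `base`, the position of `v` in the circuit, brings `v` to position 0.
    at i = vertex (inject₁ ((i + toℕ base) mod n))

    base-mod : toℕ base mod n ≡ base
    base-mod = toℕ-injective (trans (toℕ-mod n (toℕ base)) (m<n⇒m%n≡m (toℕ<n base)))

    n+base-mod : (n + toℕ base) mod n ≡ toℕ base mod n
    n+base-mod = mod-cong n
      (trans (cong (_% n) (+-comm n (toℕ base))) ([m+n]%n≡m%n (toℕ base) n))

    at-injective : ∀ {i j} → i < n → j < n → at i ≡ at j → i ≡ j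
    at-injective {i} {j} i<n j<n eq with once (at j)
    -- Uniqueness of the position of `at j` equates the rotated residues; the rotation then cancels.
    ... | _ , _ , unique = %-cancelʳ-+ n (<⇒≤ (toℕ<n base)) i<n j<n
      (trans (sym (toℕ-mod n (i + toℕ base)))
        (trans (cong toℕ (trans (sym (unique eq)) (unique refl)))
          (toℕ-mod n (j + toℕ base))))

-- From a tour to a simple path.

module _ {n : ℕ} {G : Graph n} {v : Fin n} where
  open Graph G
  open Construction G v hiding (G′)

  -- Recasts `last`, which is indexed by `n ∸ 1` and `n`, in the indices `l` and `suc l` carried by
  -- path edges.
  inner→sink : ∀ {b l} .(b≢v : b ≢ v) .(1≤l : 1 ≤ l) .(l<n : l < n) →
               suc l ≡ n → Adj v b → E′ (inner b b≢v l 1≤l l<n , sink , suc l)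
  inner→sink b≢v 1≤l l<n refl = last

  HamiltonTour⇒SimplePath : HamiltonTour G v → SimplePath (G′ G v)
  HamiltonTour⇒SimplePath tour = record
    { vertex = path ∘ toℕ
    ; start  = refl
    ; end    = trans (cong path (toℕ-fromℕ n)) (path-sink (≤-trans z<s (toℕ<n v)) ≤-refl)
    ; edge∈E = edge∈E
    ; simple = λ l i _ → simple l i
    }
    where
    open HamiltonTour tour

    at≢v : ∀ {i} → suc i < n → at (suc i) ≢ v
    at≢v i+1<n eq with () ← injective i+1<n (<-trans z<s i+1<n) (trans eq (sym at-0))

    path : ℕ → Vertex
    path zero    = source
    path (suc i) with suc i <? n
    ... | yes i+1<n = inner (at (suc i)) (at≢v i+1<n) (suc i) z<s i+1<n
    -- The default at every positive index from `n` on, which keeps `path` total on the naturals.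
    ... | no  _     = sink

    path-sink : ∀ {i} → 0 < i → n ≤ i → path i ≡ sink
    path-sink {suc i} _ n≤i+1 with suc i <? n
    ... | yes i+1<n = contradiction n≤i+1 (<⇒≱ i+1<n)
    ... | no  _     = refl

    -- The stage `m` of an inner vertex records its index on the path, so `m` must be `i`. This
    -- turns incidence in a label into an equation between tour vertices.
    path-inner : ∀ i {u m} .{u≢v : u ≢ v} .{1≤m : 1 ≤ m} .{m<n : m < n} →
                 inner u u≢v m 1≤m m<n ≡ path i → u ≡ at m
    path-inner (suc i) eq   with suc i <? n
    path-inner (suc i) refl | yes _ = refl

    path-edge : ∀ {i} → i < n → E′ (path i , path (suc i) , suc i)
    path-edge {zero} 0<n with 1 <? n
    ... | yes _   = first (subst (λ x → Adj x (at 1)) at-0 (adjacent 0<n))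
    -- Here `n` is 1, and the tour would be a loop at `v`.
    ... | no  1≮n = contradiction (adjacent 0<n) (irrefl (trans at-0 (sym at-1)))
      where
      at-1 : at 1 ≡ v
      at-1 = trans (cong at (≤-antisym 0<n (≮⇒≥ 1≮n))) at-n
    path-edge {suc i} i+1<n with suc i <? n | suc (suc i) <? n
    ... | no  i+1≮n | _     = contradiction i+1<n i+1≮n
    ... | yes _     | yes _ = middle (adjacent i+1<n)
    ... | yes p     | no i+2≮n =
      inner→sink (at≢v p) z<s p i+2≡n
        (symm (subst (Adj _) (trans (cong at i+2≡n) at-n) (adjacent i+1<n)))
      where
      i+2≡n : suc (suc i) ≡ n
      i+2≡n = ≤-antisym i+1<n (≮⇒≥ i+2≮n)

    -- An edge incident with an earlier copy of `at (suc l)`, at stage `m` say, would force `at m`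
    -- to equal `at (suc l)`, against injectivity of the tour.
    path-label : ∀ l {i} → i < n → .{≢S : path (suc l) ≢ source} →
                 label (path (suc l)) ≢S (path i , path (suc i) , suc i)
    path-label l {i} i<n with suc l <? n
    ... | no  _     = path-edge i<n
    ... | yes l+1<n = path-edge i<n , λ m _ m<l+1 → λ
      { (inj₁ eq) → avoids m<l+1 (path-inner i eq)
      ; (inj₂ eq) → avoids m<l+1 (path-inner (suc i) eq)
      }
      where
      avoids : ∀ {m} → m < suc l → at (suc l) ≢ at m
      avoids m<l+1 eq =
        <-irrefl (sym (injective l+1<n (<-trans m<l+1 l+1<n) eq)) m<l+1

    edge∈E : ∀ (i : Fin n) → E′ (path (toℕ (inject₁ i)) , path (suc (toℕ i)) , suc (toℕ i))
    edge∈E i rewrite toℕ-inject₁ i = path-edge (toℕ<n i)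

    simple : ∀ (l i : Fin n) .{≢S : path (suc (toℕ l)) ≢ source} →
             label (path (suc (toℕ l))) ≢S
                   (path (toℕ (inject₁ i)) , path (suc (toℕ i)) , suc (toℕ i))
    simple l i rewrite toℕ-inject₁ i = path-label (toℕ l) (toℕ<n i)

  -- Projecting a simple path to a closed walk.

  base : Vertex → Fin n
  base source            = v
  base (inner u _ _ _ _) = u
  -- Both ends project to `v`, which closes the walk.
  base sink              = v

  base-Adj : ∀ {x y l} → E′ (x , y , l) → Adj (base x) (base y)
  base-Adj (first v~b)  = v~b
  base-Adj (middle a~b) = a~b
  base-Adj (last v~b)   = symm v~b

  base≢v : ∀ x → 1 ≤ stage x → stage x < n → base x ≢ v
  base≢v (inner _ u≢v _ _ _) _ _   eq = Irr.⊥-elim (u≢v eq)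
  base≢v sink                _ n<n _  = <-irrefl refl n<n

  -- With equal projections, `y` would be an earlier copy of the vertex of `x`, and the label of `x`
  -- omits all edges incident with such copies.
  label-excludes : ∀ {e} x .(x≢S : x ≢ source) y → e ∈ label x x≢S → Incident e y →
                   1 ≤ stage y → stage y < stage x → stage x < n → base y ≢ base x
  label-excludes (inner u _ _ _ _) _ (inner _ _ m _ _) (_ , avoids) inc 1≤m m<l _ refl =
    avoids m 1≤m m<l inc
  label-excludes (inner _ _ _ _ _) _ sink _ _ _ n<l l<n _ = <-irrefl refl (<-trans n<l l<n)
  label-excludes sink              _ _    _ _ _ _   n<n _ = <-irrefl refl n<n

module _ {n : ℕ} {G : Graph n} {v : Fin n} (p : SimplePath (G′ G v)) where
  open Construction G v hiding (G′)
  open LabeledMultistageGraph (G′ G v) using (edge-stage)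
  open SimplePath p

  stage-vertex : ∀ i → stage (vertex i) ≡ toℕ i
  stage-vertex zero    = cong stage start
  stage-vertex (suc i) with edge-stage (edge∈E i)
  ... | _ , _ , _ , eq = eq

walk-distinct : ∀ {n} {G : Graph n} {v} (p : SimplePath (G′ G v)) (i j : Fin n) →
                toℕ i < toℕ j →
                base (SimplePath.vertex p (inject₁ i)) ≢ base (SimplePath.vertex p (inject₁ j))
walk-distinct {suc n} {G} {v} p i (suc j) i<j = go i i<j
  where
  open Construction G v hiding (G′)
  open LabeledMultistageGraph (G′ G v) using (target≢S)
  open SimplePath p

  st : ∀ (k : Fin (suc n)) → toℕ k ≡ stage (vertex (inject₁ k))
  st k = sym (trans (stage-vertex p (inject₁ k)) (toℕ-inject₁ k))

  j-interior : stage (vertex (inject₁ (suc j))) < suc n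
  j-interior = subst (_< suc n) (st (suc j)) (toℕ<n (suc j))

  go : ∀ i → toℕ i < suc (toℕ j) →
       base (vertex (inject₁ i)) ≢ base (vertex (inject₁ (suc j)))
  -- Labels only exclude edges at inner vertices, so a return to the start is ruled out separately:
  -- inner vertices do not project to `v`.
  go zero _ eq =
    base≢v (vertex (inject₁ (suc j))) (subst (1 ≤_) (st (suc j)) z<s) j-interior
           (trans (sym eq) (cong base start))
  go i@(suc _) i<j =
    -- The edge entering position `suc j` has index `inject₁ j`. The edge leaving position `i` has
    -- index at most that, so it belongs to the initial segment that the label must contain.
    label-excludes (vertex (inject₁ (suc j))) (target≢S (edge∈E (inject₁ j)))
      (vertex (inject₁ i))
      (simple (inject₁ j) i (subst (toℕ i ≤_) (sym (toℕ-inject₁ j)) (s≤s⁻¹ i<j)))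
      (inj₁ refl) (subst (1 ≤_) (st i) z<s) (subst₂ _<_ (st i) (st (suc j)) i<j)
      j-interior

SimplePath⇒IsHamilton : ∀ {n} {G : Graph n} {v} → SimplePath (G′ G v) → IsHamilton G
SimplePath⇒IsHamilton {n} {G} p = n , circuit , visits
  where
  open SimplePath p

  circuit : Circuit G n
  circuit = record
    { vertex   = base ∘ vertex
    ; adjacent = λ i → base-Adj (edge∈E i)
    ; closed   = trans (cong base end) (sym (cong base start))
    }

  walk-injective : Injective _≡_ _≡_ (base ∘ vertex ∘ inject₁)
  walk-injective {i} {j} eq with <-cmp (toℕ i) (toℕ j)
  ... | tri< i<j _ _ = contradiction eq (walk-distinct p i j i<j)
  ... | tri≈ _ i≡j _ = toℕ-injective i≡j
  ... | tri> _ _ j<i = contradiction (sym eq) (walk-distinct p j i j<i)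

  visits : VisitsEachOnce circuit
  visits x with injective⇒hits walk-injective x
  ... | i , hit = i , hit , λ hit′ → walk-injective (trans hit (sym hit′))

theorem4 : (n : ℕ) (G : Graph n) (v : Fin n) → IsHamilton G ⇔ SimplePath (G′ G v)
theorem4 n G v = mk⇔
  (λ ham → HamiltonTour⇒SimplePath (IsHamilton⇒HamiltonTour G ham v))
  SimplePath⇒IsHamilton
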